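{- Let $C$ be a concrete category (each object has an underlying set and morphisms are functions composed as functions) such that (i) set-theoretic finite products and equalizers are also finite products and equalizers in $C$, and (ii) for every $C$-morphism $f:X\to Y$ there are a $C$-object $U$ and a $C$-morphism $u:U\to X\times Y$ with the graph of $f$ equal to the range of $u$. Then $\mathrm{Rel}(C)$, equipped with the cartesian product as monoidal product and the cartesian trace, is a traced symmetric monoidal category having $C$ as a subcategory. If moreover a function between $C$-objects is a $C$-morphism if and only if its graph is the range of some $C$-morphism, then this subcategory consists precisely of those morphisms of $\mathrm{Rel}(C)$ which are set-theoretic functions.
   Context: A $C$-relation between $C$-objects $X$ and $Y$ is a relation $r\subseteq X\times Y$ which equals the range of some $C$-morphism $u:U\to X\times Y$ for some $C$-object $U$. $\mathrm{Rel}(C)$ is the category with the same objects as $C$, whose morphisms from $X$ to $Y$ are the $C$-relations between $X$ and $Y$, composed by relational composition. The cartesian trace of a relation $r\subseteq (X\times Z)\times(Y\times Z)$ is the relation $\mathsf{Tr}(r)\subseteq X\times Y$ with $(x,y)\in\mathsf{Tr}(r)$ iff there is $z\in Z$ with $((x,z),(y,z))\in r$. -}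

module Defs where

open import Level using (Level; _⊔_; suc)
open import Data.Product using (∃; ∃₂; ∃!; _×_; _,_; proj₁; proj₂)
open import Data.Product.Function.NonDependent.Setoid using (proj₁ₛ; proj₂ₛ)
open import Data.Product.Relation.Binary.Pointwise.NonDependent
  using (Pointwise; _×ₛ_)
open import Data.Unit.Polymorphic.Properties using (≡-setoid)
open import Function.Bundles using (Func; Inverse; _⟨$⟩_)
open import Function.Properties.Inverse using (toFunction)
import Function.Construct.Composition as Comp
import Function.Construct.Identity as Identity
import Function.Relation.Binary.Setoid.Equality as FuncEq
open import Relation.Binary using (Rel; REL; _⇔_; Setoid; IsEquivalence)
import Relation.Binary.Construct.On as On

private
  variable
    o h e o₁ h₁ e₁ o₂ h₂ e₂ m ℓ : Level

-- Objects, hom-sets and equality of morphisms are parameters, so that a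
-- category structure can be asserted to exist on prescribed ones.
record Category {Obj : Set o} (_⇒_ : Rel Obj h)
                (_≈_ : ∀ {A B} → Rel (A ⇒ B) e) : Set (o ⊔ h ⊔ e) where
  infixr 9 _∘_
  field
    id        : ∀ {A} → A ⇒ A
    _∘_       : ∀ {A B C} → B ⇒ C → A ⇒ B → A ⇒ C
    equiv     : ∀ {A B} → IsEquivalence (_≈_ {A} {B})
    ∘-resp-≈  : ∀ {A B C} {f f′ : B ⇒ C} {g g′ : A ⇒ B} →
                f ≈ f′ → g ≈ g′ → (f ∘ g) ≈ (f′ ∘ g′)
    identityˡ : ∀ {A B} {f : A ⇒ B} → (id ∘ f) ≈ f
    identityʳ : ∀ {A B} {f : A ⇒ B} → (f ∘ id) ≈ f
    assoc     : ∀ {A B C D} {f : A ⇒ B} {g : B ⇒ C} {k : C ⇒ D} →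
                ((k ∘ g) ∘ f) ≈ (k ∘ (g ∘ f))

module _ {Obj : Set o} {_⇒_ : Rel Obj h} {_≈_ : ∀ {A B} → Rel (A ⇒ B) e}
         (𝒞 : Category _⇒_ _≈_) where

  open Category 𝒞

  record IsTerminal (T : Obj) : Set (o ⊔ h ⊔ e) where
    field
      !        : ∀ {A} → A ⇒ T
      !-unique : ∀ {A} (f : A ⇒ T) → ! ≈ f

  record IsProduct {A B P : Obj} (π₁ : P ⇒ A) (π₂ : P ⇒ B)
                   : Set (o ⊔ h ⊔ e) where
    field
      ⟨_,_⟩    : ∀ {W} → W ⇒ A → W ⇒ B → W ⇒ P
      project₁ : ∀ {W} {f : W ⇒ A} {g : W ⇒ B} → (π₁ ∘ ⟨ f , g ⟩) ≈ f
      project₂ : ∀ {W} {f : W ⇒ A} {g : W ⇒ B} → (π₂ ∘ ⟨ f , g ⟩) ≈ g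
      unique   : ∀ {W} {f : W ⇒ A} {g : W ⇒ B} {k : W ⇒ P} →
                 (π₁ ∘ k) ≈ f → (π₂ ∘ k) ≈ g → ⟨ f , g ⟩ ≈ k

  record IsEqualizer {A B E : Obj} (i : E ⇒ A) (f g : A ⇒ B)
                     : Set (o ⊔ h ⊔ e) where
    field
      equality  : (f ∘ i) ≈ (g ∘ i)
      equalize  : ∀ {W} (k : W ⇒ A) → (f ∘ k) ≈ (g ∘ k) → W ⇒ E
      universal : ∀ {W} {k : W ⇒ A} (eq : (f ∘ k) ≈ (g ∘ k)) →
                  (i ∘ equalize k eq) ≈ k
      unique    : ∀ {W} {k : W ⇒ A} (eq : (f ∘ k) ≈ (g ∘ k)) {j : W ⇒ E} →
                  (i ∘ j) ≈ k → equalize k eq ≈ j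

  record SymmetricMonoidal (_⊗₀_ : Obj → Obj → Obj) (I : Obj)
                           : Set (o ⊔ h ⊔ e) where
    infixr 10 _⊗₁_
    field
      _⊗₁_ : ∀ {A B C D} → A ⇒ B → C ⇒ D → (A ⊗₀ C) ⇒ (B ⊗₀ D)
      ⊗-resp-≈ : ∀ {A B C D} {f f′ : A ⇒ B} {g g′ : C ⇒ D} →
                 f ≈ f′ → g ≈ g′ → (f ⊗₁ g) ≈ (f′ ⊗₁ g′)
      ⊗-identity : ∀ {A B} → (id {A} ⊗₁ id {B}) ≈ id
      ⊗-homomorphism :
        ∀ {A B C A′ B′ C′} {f : A ⇒ B} {g : B ⇒ C} {f′ : A′ ⇒ B′} {g′ : B′ ⇒ C′} →
        ((g ∘ f) ⊗₁ (g′ ∘ f′)) ≈ ((g ⊗₁ g′) ∘ (f ⊗₁ f′))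

      α   : ∀ {A B C} → ((A ⊗₀ B) ⊗₀ C) ⇒ (A ⊗₀ (B ⊗₀ C))
      α⁻¹ : ∀ {A B C} → (A ⊗₀ (B ⊗₀ C)) ⇒ ((A ⊗₀ B) ⊗₀ C)
      α-isoˡ : ∀ {A B C} → (α⁻¹ ∘ α {A} {B} {C}) ≈ id
      α-isoʳ : ∀ {A B C} → (α {A} {B} {C} ∘ α⁻¹) ≈ id
      α-natural :
        ∀ {A B C A′ B′ C′} {f : A ⇒ A′} {g : B ⇒ B′} {k : C ⇒ C′} →
        (α ∘ ((f ⊗₁ g) ⊗₁ k)) ≈ ((f ⊗₁ (g ⊗₁ k)) ∘ α)

      lu   : ∀ {A} → (I ⊗₀ A) ⇒ A
      lu⁻¹ : ∀ {A} → A ⇒ (I ⊗₀ A)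
      lu-isoˡ : ∀ {A} → (lu⁻¹ ∘ lu {A}) ≈ id
      lu-isoʳ : ∀ {A} → (lu {A} ∘ lu⁻¹) ≈ id
      lu-natural : ∀ {A B} {f : A ⇒ B} → (lu ∘ (id ⊗₁ f)) ≈ (f ∘ lu)

      ru   : ∀ {A} → (A ⊗₀ I) ⇒ A
      ru⁻¹ : ∀ {A} → A ⇒ (A ⊗₀ I)
      ru-isoˡ : ∀ {A} → (ru⁻¹ ∘ ru {A}) ≈ id
      ru-isoʳ : ∀ {A} → (ru {A} ∘ ru⁻¹) ≈ id
      ru-natural : ∀ {A B} {f : A ⇒ B} → (ru ∘ (f ⊗₁ id)) ≈ (f ∘ ru)

      triangle : ∀ {A B} → ((id {A} ⊗₁ lu {B}) ∘ α) ≈ (ru ⊗₁ id)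
      pentagon : ∀ {A B C D} →
        ((id {A} ⊗₁ α {B} {C} {D}) ∘ (α ∘ (α ⊗₁ id))) ≈ (α ∘ α)

      σ : ∀ {A B} → (A ⊗₀ B) ⇒ (B ⊗₀ A)
      σ-natural : ∀ {A B A′ B′} {f : A ⇒ A′} {g : B ⇒ B′} →
        (σ ∘ (f ⊗₁ g)) ≈ ((g ⊗₁ f) ∘ σ)
      σ-involutive : ∀ {A B} → (σ ∘ σ {A} {B}) ≈ id
      hexagon : ∀ {A B C} →
        ((id {B} ⊗₁ σ {A} {C}) ∘ (α ∘ (σ ⊗₁ id))) ≈ (α ∘ (σ ∘ α))

-- The trace axioms of Joyal, Street and Verity, in the symmetric case.
record Traced {Obj : Set o} {_⇒_ : Rel Obj h} {_≈_ : ∀ {A B} → Rel (A ⇒ B) e}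
              {𝒞 : Category _⇒_ _≈_} {_⊗₀_ : Obj → Obj → Obj} {I : Obj}
              (ℳ : SymmetricMonoidal 𝒞 _⊗₀_ I) : Set (o ⊔ h ⊔ e) where
  open Category 𝒞
  open SymmetricMonoidal ℳ
  field
    tr : ∀ {X Y Z} → (X ⊗₀ Z) ⇒ (Y ⊗₀ Z) → X ⇒ Y
    tr-resp-≈ : ∀ {X Y Z} {f g : (X ⊗₀ Z) ⇒ (Y ⊗₀ Z)} → f ≈ g → tr f ≈ tr g
    tightening :
      ∀ {X X′ Y Y′ Z} {g : X′ ⇒ X} {f : (X ⊗₀ Z) ⇒ (Y ⊗₀ Z)} {k : Y ⇒ Y′} →
      tr ((k ⊗₁ id) ∘ (f ∘ (g ⊗₁ id))) ≈ (k ∘ (tr f ∘ g))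
    sliding :
      ∀ {X Y Z Z′} {f : (X ⊗₀ Z) ⇒ (Y ⊗₀ Z′)} {g : Z′ ⇒ Z} →
      tr ((id ⊗₁ g) ∘ f) ≈ tr (f ∘ (id ⊗₁ g))
    vanishing-I :
      ∀ {X Y} {f : (X ⊗₀ I) ⇒ (Y ⊗₀ I)} → tr f ≈ (ru ∘ (f ∘ ru⁻¹))
    vanishing-⊗ :
      ∀ {X Y Z W} {f : ((X ⊗₀ Z) ⊗₀ W) ⇒ ((Y ⊗₀ Z) ⊗₀ W)} →
      tr {Z = Z ⊗₀ W} (α ∘ (f ∘ α⁻¹)) ≈ tr (tr f)
    superposing :
      ∀ {W X Y Z} {f : (X ⊗₀ Z) ⇒ (Y ⊗₀ Z)} →
      tr (α⁻¹ ∘ ((id {W} ⊗₁ f) ∘ α)) ≈ (id {W} ⊗₁ tr f)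
    yanking : ∀ {X} → tr (σ {X} {X}) ≈ id

record Functor {Obj₁ : Set o₁} {_⇒₁_ : Rel Obj₁ h₁}
               {_≈₁_ : ∀ {A B} → Rel (A ⇒₁ B) e₁}
               {Obj₂ : Set o₂} {_⇒₂_ : Rel Obj₂ h₂}
               {_≈₂_ : ∀ {A B} → Rel (A ⇒₂ B) e₂}
               (𝒞 : Category _⇒₁_ _≈₁_) (𝒟 : Category _⇒₂_ _≈₂_)
               (F₀ : Obj₁ → Obj₂)
               : Set (o₁ ⊔ h₁ ⊔ e₁ ⊔ o₂ ⊔ h₂ ⊔ e₂) where
  private
    module 𝒞 = Category 𝒞
    module 𝒟 = Category 𝒟
  field
    F₁           : ∀ {A B} → A ⇒₁ B → F₀ A ⇒₂ F₀ B
    F-resp-≈     : ∀ {A B} {f g : A ⇒₁ B} → f ≈₁ g → F₁ f ≈₂ F₁ g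
    identity     : ∀ {A} → F₁ (𝒞.id {A}) ≈₂ 𝒟.id
    homomorphism : ∀ {A B C} {f : A ⇒₁ B} {g : B ⇒₁ C} →
                   F₁ (g 𝒞.∘ f) ≈₂ (F₁ g 𝒟.∘ F₁ f)

  Faithful : Set (o₁ ⊔ h₁ ⊔ e₁ ⊔ e₂)
  Faithful = ∀ {A B} {f g : A ⇒₁ B} → F₁ f ≈₂ F₁ g → f ≈₁ g

-- Sets are setoids; a set with propositional equality is a special case.
-- Carrier and equality share one level, so that graphs, ranges and composites
-- of relations all live at that level.
record ConcreteCategory (o m ℓ : Level) : Set (suc (o ⊔ m ⊔ ℓ)) where
  field
    Obj : Set o
    ∣_∣ : Obj → Setoid ℓ ℓ
    IsMorphism : ∀ {X Y} → Func ∣ X ∣ ∣ Y ∣ → Set m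
    -- IsMorphism is a property of functions up to pointwise equality.
    IsMorphism-resp : ∀ {X Y} {f g : Func ∣ X ∣ ∣ Y ∣} →
      FuncEq._≈_ ∣ X ∣ ∣ Y ∣ f g → IsMorphism f → IsMorphism g
    id-isMorphism : ∀ {X} → IsMorphism (Identity.function ∣ X ∣)
    ∘-isMorphism : ∀ {X Y Z} {f : Func ∣ X ∣ ∣ Y ∣} {g : Func ∣ Y ∣ ∣ Z ∣} →
      IsMorphism f → IsMorphism g → IsMorphism (Comp.function f g)

  record Morphism (X Y : Obj) : Set (m ⊔ ℓ) where
    constructor mor
    field
      fun        : Func ∣ X ∣ ∣ Y ∣
      isMorphism : IsMorphism fun

  open Morphism public

  infix 4 _≈ₘ_
  _≈ₘ_ : ∀ {X Y} → Rel (Morphism X Y) ℓ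
  _≈ₘ_ {X} {Y} f g = FuncEq._≈_ ∣ X ∣ ∣ Y ∣ (fun f) (fun g)

  category : Category Morphism _≈ₘ_
  category = record
    { id        = mor _ id-isMorphism
    ; _∘_       = λ g f → mor _ (∘-isMorphism (isMorphism f) (isMorphism g))
    ; equiv     = λ {X} {Y} →
        On.isEquivalence fun (FuncEq.isEquivalence ∣ X ∣ ∣ Y ∣)
    ; ∘-resp-≈  = λ {_} {_} {Z} {f} {_} {_} {g′} f≈f′ g≈g′ x →
        Setoid.trans ∣ Z ∣ (Func.cong (fun f) (g≈g′ x)) (f≈f′ (fun g′ ⟨$⟩ x))
    ; identityˡ = λ {_} {Y} _ → Setoid.refl ∣ Y ∣
    ; identityʳ = λ {_} {Y} _ → Setoid.refl ∣ Y ∣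
    ; assoc     = λ {_} {_} {_} {Z} _ → Setoid.refl ∣ Z ∣
    }

module _ (C : ConcreteCategory o m ℓ) where

  open ConcreteCategory C

  -- In the next three records, the underlying set of an object of C is
  -- identified with the set-theoretic limit along a given bijection.
  record SetTerminal : Set (o ⊔ m ⊔ ℓ) where
    field
      obj        : Obj
      bijection  : Inverse ∣ obj ∣ (≡-setoid ℓ)
      isTerminal : IsTerminal category obj

  record SetProduct (X Y : Obj) : Set (o ⊔ m ⊔ ℓ) where
    field
      obj       : Obj
      bijection : Inverse ∣ obj ∣ (∣ X ∣ ×ₛ ∣ Y ∣)
      π₁-isMorphism : IsMorphism {obj} {X} (Comp.function (toFunction bijection) proj₁ₛ)
      π₂-isMorphism : IsMorphism {obj} {Y} (Comp.function (toFunction bijection) proj₂ₛ)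
      isProduct : IsProduct category (mor _ π₁-isMorphism) (mor _ π₂-isMorphism)

  equalizerSetoid : ∀ {X Y} (f g : Morphism X Y) → Setoid ℓ ℓ
  equalizerSetoid {X} {Y} f g =
    On.setoid ∣ X ∣ (proj₁ {B = λ x → Setoid._≈_ ∣ Y ∣ (fun f ⟨$⟩ x) (fun g ⟨$⟩ x)})

  equalizerInclusion : ∀ {X Y} (f g : Morphism X Y) → Func (equalizerSetoid f g) ∣ X ∣
  equalizerInclusion f g = record { to = proj₁ ; cong = λ eq → eq }

  record SetEqualizer {X Y : Obj} (f g : Morphism X Y) : Set (o ⊔ m ⊔ ℓ) where
    field
      obj       : Obj
      bijection : Inverse ∣ obj ∣ (equalizerSetoid f g)
      inclusion-isMorphism :
        IsMorphism {obj} {X} (Comp.function (toFunction bijection) (equalizerInclusion f g))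
      isEqualizer : IsEqualizer category (mor _ inclusion-isMorphism) f g

  record SetFiniteLimits : Set (o ⊔ m ⊔ ℓ) where
    field
      terminal  : SetTerminal
      product   : ∀ X Y → SetProduct X Y
      equalizer : ∀ {X Y} (f g : Morphism X Y) → SetEqualizer f g

module _ {C : ConcreteCategory o m ℓ} (L : SetFiniteLimits C) where

  open ConcreteCategory C
  open SetFiniteLimits L

  private
    El : Obj → Set ℓ
    El X = Setoid.Carrier ∣ X ∣

    Eq : ∀ X → Rel (El X) ℓ
    Eq X = Setoid._≈_ ∣ X ∣

  infixr 10 _⊠_
  _⊠_ : Obj → Obj → Obj
  X ⊠ Y = SetProduct.obj (product X Y)

  𝟙 : Obj
  𝟙 = SetTerminal.obj terminal

  split : ∀ {X Y} → El (X ⊠ Y) → El X × El Y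
  split {X} {Y} = Inverse.to (SetProduct.bijection (product X Y))

  fst : ∀ {X Y} → El (X ⊠ Y) → El X
  fst p = proj₁ (split p)

  snd : ∀ {X Y} → El (X ⊠ Y) → El Y
  snd p = proj₂ (split p)

  pair : ∀ {X Y} → El X → El Y → El (X ⊠ Y)
  pair {X} {Y} x y = Inverse.from (SetProduct.bijection (product X Y)) (x , y)

  Graph : ∀ {X Y} → Func ∣ X ∣ ∣ Y ∣ → REL (El X) (El Y) ℓ
  Graph {Y = Y} f x y = Eq Y (f ⟨$⟩ x) y

  Range : ∀ {U X Y} → Morphism U (X ⊠ Y) → REL (El X) (El Y) ℓ
  Range {_} {X} {Y} u x y =
    ∃ λ w → Setoid._≈_ (∣ X ∣ ×ₛ ∣ Y ∣) (split (fun u ⟨$⟩ w)) (x , y)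

  IsCRelation : ∀ {X Y} → REL (El X) (El Y) ℓ → Set (o ⊔ m ⊔ ℓ)
  IsCRelation {X} {Y} r = ∃₂ λ U (u : Morphism U (X ⊠ Y)) → r ⇔ Range u

  record CRelation (X Y : Obj) : Set (o ⊔ m ⊔ suc ℓ) where
    constructor crel
    field
      rel         : REL (El X) (El Y) ℓ
      isCRelation : IsCRelation {X} {Y} rel

  open CRelation public

  infix 4 _≐_
  _≐_ : ∀ {X Y} → Rel (CRelation X Y) ℓ
  r ≐ s = rel r ⇔ rel s

  GraphsAreCRelations : Set (o ⊔ m ⊔ ℓ)
  GraphsAreCRelations =
    ∀ {X Y} (f : Morphism X Y) → IsCRelation {X} {Y} (Graph {X} {Y} (fun f))

  IsFunctional : ∀ {X Y} → CRelation X Y → Set ℓ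
  IsFunctional {X} {Y} r = ∀ x → ∃! (Eq Y) (rel r x)

  record IsRelational (𝓡 : Category CRelation _≐_) : Set (o ⊔ m ⊔ suc ℓ) where
    open Category 𝓡
    field
      id-rel : ∀ {X} → rel (id {X}) ⇔ Eq X
      ∘-rel  : ∀ {X Y Z} (s : CRelation Y Z) (r : CRelation X Y) →
               rel (s ∘ r) ⇔ λ x z → ∃ λ y → rel r x y × rel s y z

  -- The inverses α⁻¹, lu⁻¹ and ru⁻¹ are determined by α, lu and ru.
  record IsCartesian {𝓡 : Category CRelation _≐_}
                     (ℳ : SymmetricMonoidal 𝓡 _⊠_ 𝟙) : Set (o ⊔ m ⊔ suc ℓ) where
    open SymmetricMonoidal ℳ
    field
      ⊗-rel : ∀ {X X′ Y Y′} (r : CRelation X Y) (s : CRelation X′ Y′) →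
              rel (r ⊗₁ s) ⇔ λ p q → Pointwise (rel r) (rel s) (split p) (split q)
      α-rel : ∀ {X Y Z} → rel (α {X} {Y} {Z}) ⇔ λ p q →
              Eq X (fst (fst p)) (fst q) ×
              Eq Y (snd (fst p)) (fst (snd q)) ×
              Eq Z (snd p) (snd (snd q))
      lu-rel : ∀ {X} → rel (lu {X}) ⇔ λ p x → Eq X (snd p) x
      ru-rel : ∀ {X} → rel (ru {X}) ⇔ λ p x → Eq X (fst p) x
      σ-rel  : ∀ {X Y} → rel (σ {X} {Y}) ⇔ λ p q →
               Eq X (fst p) (snd q) × Eq Y (snd p) (fst q)

  IsCartesianTrace : {𝓡 : Category CRelation _≐_} {ℳ : SymmetricMonoidal 𝓡 _⊠_ 𝟙} →
                     Traced ℳ → Set (o ⊔ m ⊔ suc ℓ)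
  IsCartesianTrace 𝒯 = ∀ {X Y Z} (r : CRelation (X ⊠ Z) (Y ⊠ Z)) →
    rel (tr r) ⇔ λ x y → ∃ λ z → rel r (pair x z) (pair y z)
    where open Traced 𝒯

{-# OPTIONS --safe #-}

-- C-relations are closed under composition, product and trace: each result is
-- the range of a pair of legs out of the parametrizing object (the product of
-- the two, when there are two), restricted by an equalizer when a variable is
-- shared. Both sides of a coherence equation are functional relations, so it
-- is enough to evaluate them on tuples. Composing with the graph of a bijection
-- is substitution, so naturality and the trace axioms become substitutions in
-- a single relation.
module Submission where

open import Defs
open import Level using (Level; _⊔_)
open import Data.Product using (Σ-syntax; ∃; _×_; _,_; proj₁; proj₂)
open import Function.Base using (id)
open import Function.Bundles using (Func; _⇔_; mk⇔; Equivalence; Inverse; _⟨$⟩_)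
import Relation.Binary.Core as B
open import Relation.Binary using (REL; IsEquivalence; Setoid)

-- Equality of relations by mutual inclusion.

⇔-isEquivalence : ∀ {a b ℓ} {A : Set a} {B : Set b} →
  IsEquivalence (B._⇔_ {A = A} {B = B} {ℓ₁ = ℓ} {ℓ₂ = ℓ})
⇔-isEquivalence = record
  { refl  = (λ r → r) , (λ r → r)
  ; sym   = λ (to , from) → from , to
  ; trans = λ (to , from) (to′ , from′) → (λ r → to′ (to r)) , (λ r → from (from′ r))
  }

private
  module ⇔ {a b ℓ} {A : Set a} {B : Set b} =
    IsEquivalence (⇔-isEquivalence {a} {b} {ℓ} {A} {B})

module _ {o m ℓ : Level} {C : ConcreteCategory o m ℓ} (L : SetFiniteLimits C) where

  open ConcreteCategory C
  open SetFiniteLimits L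
  open Category category using () renaming (_∘_ to _∘ₘ_; id to idₘ)

  private
    El : Obj → Set ℓ
    El X = Setoid.Carrier ∣ X ∣

    infixr 10 _⊗_
    _⊗_ : Obj → Obj → Obj
    _⊗_ = _⊠_ L

    infix 4 _≈_
    _≈_ : ∀ {X} → El X → El X → Set ℓ
    _≈_ {X} = Setoid._≈_ ∣ X ∣

    refl : ∀ {X} {x : El X} → x ≈ x
    refl {X} = Setoid.refl ∣ X ∣

    sym : ∀ {X} {x y : El X} → x ≈ y → y ≈ x
    sym {X} = Setoid.sym ∣ X ∣

    trans : ∀ {X} {x y z : El X} → x ≈ y → y ≈ z → x ≈ z
    trans {X} = Setoid.trans ∣ X ∣

    infixr 5 _$ₘ_
    _$ₘ_ : ∀ {X Y} → Morphism X Y → El X → El Y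
    f $ₘ x = fun f ⟨$⟩ x

  -- Tuples in product objects.

  fst-cong : ∀ {X Y} {p q : El (X ⊗ Y)} → p ≈ q → fst L p ≈ fst L q
  fst-cong {X} {Y} e = proj₁ (Inverse.to-cong (SetProduct.bijection (product X Y)) e)

  snd-cong : ∀ {X Y} {p q : El (X ⊗ Y)} → p ≈ q → snd L p ≈ snd L q
  snd-cong {X} {Y} e = proj₂ (Inverse.to-cong (SetProduct.bijection (product X Y)) e)

  pair-cong : ∀ {X Y} {x x′ : El X} {y y′ : El Y} →
    x ≈ x′ → y ≈ y′ → pair L x y ≈ pair L x′ y′
  pair-cong {X} {Y} e e′ = Inverse.from-cong (SetProduct.bijection (product X Y)) (e , e′)

  fst-pair : ∀ {X Y} {x : El X} {y : El Y} → fst L (pair L x y) ≈ x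
  fst-pair {X} {Y} =
    proj₁ (Inverse.strictlyInverseˡ (SetProduct.bijection (product X Y)) _)

  snd-pair : ∀ {X Y} {x : El X} {y : El Y} → snd L (pair L x y) ≈ y
  snd-pair {X} {Y} =
    proj₂ (Inverse.strictlyInverseˡ (SetProduct.bijection (product X Y)) _)

  pair-η : ∀ {X Y} {p : El (X ⊗ Y)} → pair L (fst L p) (snd L p) ≈ p
  pair-η {X} {Y} = Inverse.strictlyInverseʳ (SetProduct.bijection (product X Y)) _

  pair-unique : ∀ {X Y} {p : El (X ⊗ Y)} {x y} → fst L p ≈ x → snd L p ≈ y → p ≈ pair L x y
  pair-unique e e′ = trans (sym pair-η) (pair-cong e e′)

  pair-injective₁ : ∀ {X Y} {x x′ : El X} {y y′ : El Y} →
    pair L x y ≈ pair L x′ y′ → x ≈ x′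
  pair-injective₁ e = trans (sym fst-pair) (trans (fst-cong e) fst-pair)

  pair-injective₂ : ∀ {X Y} {x x′ : El X} {y y′ : El Y} →
    pair L x y ≈ pair L x′ y′ → y ≈ y′
  pair-injective₂ e = trans (sym snd-pair) (trans (snd-cong e) snd-pair)

  -- The images of `s` and `t` in the one-element set coincide definitionally, and the bijection
  -- carries that image back to each of them.
  𝟙-unique : ∀ {s t : El (𝟙 L)} → s ≈ t
  𝟙-unique = trans (sym (I.strictlyInverseʳ _)) (I.strictlyInverseʳ _)
    where module I = Inverse (SetTerminal.bijection terminal)

  -- Pairings and structural morphisms of C.

  π₁ : ∀ {X Y} → Morphism (X ⊗ Y) X
  π₁ {X} {Y} = mor _ (SetProduct.π₁-isMorphism (product X Y))

  π₂ : ∀ {X Y} → Morphism (X ⊗ Y) Y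
  π₂ {X} {Y} = mor _ (SetProduct.π₂-isMorphism (product X Y))

  ⟪_,_⟫ : ∀ {W X Y} → Morphism W X → Morphism W Y → Morphism W (X ⊗ Y)
  ⟪_,_⟫ {_} {X} {Y} = IsProduct.⟨_,_⟩ (SetProduct.isProduct (product X Y))

  !ₘ : ∀ {X} → Morphism X (𝟙 L)
  !ₘ = IsTerminal.! (SetTerminal.isTerminal terminal)

  module _ {W X Y : Obj} {f : Morphism W X} {g : Morphism W Y} where

    -- The projections of C are the set-theoretic ones, so the triangle of the universal property is
    -- already a statement about components.
    fst-⟪⟫ : ∀ w → fst L (⟪ f , g ⟫ $ₘ w) ≈ (f $ₘ w)
    fst-⟪⟫ = IsProduct.project₁ (SetProduct.isProduct (product X Y)) {f = f} {g = g}

    snd-⟪⟫ : ∀ w → snd L (⟪ f , g ⟫ $ₘ w) ≈ (g $ₘ w)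
    snd-⟪⟫ = IsProduct.project₂ (SetProduct.isProduct (product X Y)) {f = f} {g = g}

    ⟪⟫-≈ : ∀ {w x y} → (f $ₘ w) ≈ x → (g $ₘ w) ≈ y → (⟪ f , g ⟫ $ₘ w) ≈ pair L x y
    ⟪⟫-≈ e e′ = pair-unique (trans (fst-⟪⟫ _) e) (trans (snd-⟪⟫ _) e′)

  αₘ : ∀ {X Y Z} → Morphism ((X ⊗ Y) ⊗ Z) (X ⊗ (Y ⊗ Z))
  αₘ = ⟪ π₁ ∘ₘ π₁ , ⟪ π₂ ∘ₘ π₁ , π₂ ⟫ ⟫

  αₘ⁻¹ : ∀ {X Y Z} → Morphism (X ⊗ (Y ⊗ Z)) ((X ⊗ Y) ⊗ Z)
  αₘ⁻¹ = ⟪ ⟪ π₁ , π₁ ∘ₘ π₂ ⟫ , π₂ ∘ₘ π₂ ⟫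

  σₘ : ∀ {X Y} → Morphism (X ⊗ Y) (Y ⊗ X)
  σₘ = ⟪ π₂ , π₁ ⟫

  luₘ⁻¹ : ∀ {X} → Morphism X (𝟙 L ⊗ X)
  luₘ⁻¹ = ⟪ !ₘ , idₘ ⟫

  ruₘ⁻¹ : ∀ {X} → Morphism X (X ⊗ 𝟙 L)
  ruₘ⁻¹ = ⟪ idₘ , !ₘ ⟫

  αₘ-pair : ∀ {X Y Z} {x : El X} {y : El Y} {z : El Z} →
    (αₘ $ₘ pair L (pair L x y) z) ≈ pair L x (pair L y z)
  αₘ-pair = ⟪⟫-≈ (trans (fst-cong fst-pair) fst-pair)
                 (⟪⟫-≈ (trans (snd-cong fst-pair) snd-pair) snd-pair)

  αₘ⁻¹-pair : ∀ {X Y Z} {x : El X} {y : El Y} {z : El Z} →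
    (αₘ⁻¹ $ₘ pair L x (pair L y z)) ≈ pair L (pair L x y) z
  αₘ⁻¹-pair = ⟪⟫-≈ (⟪⟫-≈ fst-pair (trans (fst-cong snd-pair) fst-pair))
                   (trans (snd-cong snd-pair) snd-pair)

  σₘ-pair : ∀ {X Y} {x : El X} {y : El Y} → (σₘ $ₘ pair L x y) ≈ pair L y x
  σₘ-pair = ⟪⟫-≈ snd-pair fst-pair

  luₘ⁻¹-pair : ∀ {X} {t} {x : El X} → (luₘ⁻¹ $ₘ x) ≈ pair L t x
  luₘ⁻¹-pair = ⟪⟫-≈ 𝟙-unique refl

  ruₘ⁻¹-pair : ∀ {X} {t} {x : El X} → (ruₘ⁻¹ $ₘ x) ≈ pair L x t
  ruₘ⁻¹-pair = ⟪⟫-≈ refl 𝟙-unique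

  -- Puts an arbitrary element into the nested form on which `αₘ-pair` evaluates.
  pair₃-η : ∀ {X Y Z} {p : El ((X ⊗ Y) ⊗ Z)} →
    pair L (pair L (fst L (fst L p)) (snd L (fst L p))) (snd L p) ≈ p
  pair₃-η = trans (pair-cong pair-η refl) pair-η

  pair₃-η′ : ∀ {X Y Z} {p : El (X ⊗ (Y ⊗ Z))} →
    pair L (fst L p) (pair L (fst L (snd L p)) (snd L (snd L p))) ≈ p
  pair₃-η′ = trans (pair-cong refl pair-η) pair-η

  -- Links the graph of `αₘ`, defined by pairings, to the componentwise description demanded of a
  -- cartesian associator.
  αₘ-graph : ∀ {X Y Z} → B._⇔_ (Graph L {(X ⊗ Y) ⊗ Z} (fun αₘ)) (λ p q →
    fst L (fst L p) ≈ fst L q ×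
    snd L (fst L p) ≈ fst L (snd L q) ×
    snd L p ≈ snd L (snd L q))
  αₘ-graph =
      (λ h → trans (sym (fst-⟪⟫ _)) (fst-cong h)
           , trans (sym (trans (fst-cong (snd-⟪⟫ _)) (fst-⟪⟫ _))) (fst-cong (snd-cong h))
           , trans (sym (trans (snd-cong (snd-⟪⟫ _)) (snd-⟪⟫ _))) (snd-cong (snd-cong h)))
    , (λ (e , e′ , e″) → trans (⟪⟫-≈ e (⟪⟫-≈ e′ e″)) pair₃-η′)

  σₘ-graph : ∀ {X Y} → B._⇔_ (Graph L {X ⊗ Y} (fun σₘ)) (λ p q →
    fst L p ≈ snd L q × snd L p ≈ fst L q)
  σₘ-graph =
      (λ h → trans (sym (snd-⟪⟫ _)) (snd-cong h) , trans (sym (fst-⟪⟫ _)) (fst-cong h))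
    , (λ (e , e′) → trans (⟪⟫-≈ e′ e) pair-η)

  -- Closure properties of C-relations.

  IsCRelation-resp : ∀ {X Y} {r s : REL (El X) (El Y) ℓ} →
    B._⇔_ r s → IsCRelation L {X} {Y} r → IsCRelation L {X} {Y} s
  IsCRelation-resp e (U , u , e′) =
    U , u , ⇔.trans (⇔.sym e) e′

  -- A range is closed under equality of its points, since membership is itself stated up to
  -- equality.
  rel-resp : ∀ {X Y} (r : CRelation L X Y) {x x′ y y′} →
    x ≈ x′ → y ≈ y′ → rel r x y → rel r x′ y′
  rel-resp (crel _ (_ , _ , to , from)) e e′ h =
    let w , a , b = to h in from (w , trans a e , trans b e′)

  -- The pairing of the legs is a single morphism into the product, so parametrizations may be given
  -- one leg at a time.
  spanIsCRelation : ∀ {U X Y} (a : Morphism U X) (b : Morphism U Y) →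
    IsCRelation L {X} {Y} (λ x y → ∃ λ w → (a $ₘ w) ≈ x × (b $ₘ w) ≈ y)
  spanIsCRelation {U} a b = U , ⟪ a , b ⟫
    , (λ (w , e , e′) → w , trans (fst-⟪⟫ w) e , trans (snd-⟪⟫ w) e′)
    , (λ (w , e , e′) → w , trans (sym (fst-⟪⟫ w)) e , trans (sym (snd-⟪⟫ w)) e′)

  -- The underlying set of the equalizer is in bijection with the solutions of the equation, so the
  -- legs restricted along its inclusion form a span over exactly these. A solution returns only up
  -- to equality, which the legs preserve.
  equalizedSpanIsCRelation :
    ∀ {U V X Y} (f g : Morphism U V) (a : Morphism U X) (b : Morphism U Y) →
    IsCRelation L {X} {Y}
      (λ x y → ∃ λ w → (f $ₘ w) ≈ (g $ₘ w) × (a $ₘ w) ≈ x × (b $ₘ w) ≈ y)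
  equalizedSpanIsCRelation f g a b = IsCRelation-resp
    ( (λ (w , e , e′) → proj₁ (I.to w) , proj₂ (I.to w) , e , e′)
    , (λ (w , eq , e , e′) →
        let i = I.strictlyInverseˡ (w , eq) in
        I.from (w , eq) , trans (Func.cong (fun a) i) e , trans (Func.cong (fun b) i) e′) )
    (spanIsCRelation (a ∘ₘ incl) (b ∘ₘ incl))
    where
    module E = SetEqualizer (equalizer f g)
    module I = Inverse E.bijection
    incl = mor _ E.inclusion-isMorphism

  -- Abstract, since unifying C-relations must not compare the parametrizations.
  abstract

    ∘-isCRelation : ∀ {X Y Z} (s : CRelation L Y Z) (r : CRelation L X Y) →
      IsCRelation L {X} {Z} (λ x z → ∃ λ y → rel r x y × rel s y z)
    ∘-isCRelation (crel s (_ , v , vto , vfrom)) (crel r (_ , u , uto , ufrom)) = IsCRelation-resp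
      -- The middle value is the second component of `u` at the first parameter; `eq` identifies it
      -- with the first component of `v` at the second.
      ( (λ (w , eq , e , e′) → _ , ufrom (fst L w , e , refl) , vfrom (snd L w , sym eq , e′))
      , (λ (y , h , k) → let w , e₁ , e₂ = uto h ; w′ , e₃ , e₄ = vto k in
          pair L w w′
          , trans (snd-cong (Func.cong (fun u) fst-pair)) (trans e₂ (trans (sym e₃)
              (sym (fst-cong (Func.cong (fun v) snd-pair)))))
          , trans (fst-cong (Func.cong (fun u) fst-pair)) e₁
          , trans (snd-cong (Func.cong (fun v) snd-pair)) e₄) )
      (equalizedSpanIsCRelation (π₂ ∘ₘ u ∘ₘ π₁) (π₁ ∘ₘ v ∘ₘ π₂)
                                (π₁ ∘ₘ u ∘ₘ π₁) (π₂ ∘ₘ v ∘ₘ π₂))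

    ⊗-isCRelation : ∀ {X Y X′ Y′} (r : CRelation L X Y) (s : CRelation L X′ Y′) →
      IsCRelation L {X ⊗ X′} {Y ⊗ Y′}
        (λ p q → rel r (fst L p) (fst L q) × rel s (snd L p) (snd L q))
    ⊗-isCRelation (crel r (_ , u , uto , ufrom)) (crel s (_ , v , vto , vfrom)) = IsCRelation-resp
      ( (λ (w , e , e′) →
          ufrom (fst L w , trans (sym (fst-⟪⟫ w)) (fst-cong e)
                         , trans (sym (fst-⟪⟫ w)) (fst-cong e′))
        , vfrom (snd L w , trans (sym (snd-⟪⟫ w)) (snd-cong e)
                         , trans (sym (snd-⟪⟫ w)) (snd-cong e′)))
      , (λ (h , k) → let w , e₁ , e₂ = uto h ; w′ , e₃ , e₄ = vto k in
          pair L w w′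
          , trans (⟪⟫-≈ (trans (fst-cong (Func.cong (fun u) fst-pair)) e₁)
                        (trans (fst-cong (Func.cong (fun v) snd-pair)) e₃)) pair-η
          , trans (⟪⟫-≈ (trans (snd-cong (Func.cong (fun u) fst-pair)) e₂)
                        (trans (snd-cong (Func.cong (fun v) snd-pair)) e₄)) pair-η) )
      (spanIsCRelation ⟪ π₁ ∘ₘ u ∘ₘ π₁ , π₁ ∘ₘ v ∘ₘ π₂ ⟫
                       ⟪ π₂ ∘ₘ u ∘ₘ π₁ , π₂ ∘ₘ v ∘ₘ π₂ ⟫)

    tr-isCRelation : ∀ {X Y Z} (r : CRelation L (X ⊗ Z) (Y ⊗ Z)) →
      IsCRelation L {X} {Y} (λ x y → ∃ λ z → rel r (pair L x z) (pair L y z))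
    tr-isCRelation (crel r (_ , u , uto , ufrom)) = IsCRelation-resp
      -- The feedback value is the `Z`-component on the source side; `eq` says that the target side
      -- has the same one.
      ( (λ (w , eq , e , e′) → _ , ufrom (w , pair-unique e refl , pair-unique e′ (sym eq)))
      , (λ (z , h) → let w , e , e′ = uto h in
          w , trans (trans (snd-cong e) snd-pair) (sym (trans (snd-cong e′) snd-pair))
            , trans (fst-cong e) fst-pair , trans (fst-cong e′) fst-pair) )
      (equalizedSpanIsCRelation (π₂ ∘ₘ π₁ ∘ₘ u) (π₂ ∘ₘ π₂ ∘ₘ u)
                                (π₁ ∘ₘ π₁ ∘ₘ u) (π₁ ∘ₘ π₂ ∘ₘ u))

  infixr 9 _∘ᵣ_
  _∘ᵣ_ : ∀ {X Y Z} → CRelation L Y Z → CRelation L X Y → CRelation L X Z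
  s ∘ᵣ r = crel (λ x z → ∃ λ y → rel r x y × rel s y z) (∘-isCRelation s r)

  infixr 10 _⊗ᵣ_
  _⊗ᵣ_ : ∀ {X Y X′ Y′} → CRelation L X Y → CRelation L X′ Y′ →
         CRelation L (X ⊗ X′) (Y ⊗ Y′)
  r ⊗ᵣ s = crel (λ p q → rel r (fst L p) (fst L q) × rel s (snd L p) (snd L q))
                (⊗-isCRelation r s)

  trᵣ : ∀ {X Y Z} → CRelation L (X ⊗ Z) (Y ⊗ Z) → CRelation L X Y
  trᵣ r = crel (λ x y → ∃ λ z → rel r (pair L x z) (pair L y z)) (tr-isCRelation r)

  -- Evaluation of relations at points where they are single-valued.

  record Maps {X Y} (r : CRelation L X Y) (x : El X) (y : El Y) : Set (o ⊔ m ⊔ ℓ) where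
    constructor maps
    field
      related : rel r x y
      unique  : ∀ {y′} → rel r x y′ → y ≈ y′

  maps-∘ : ∀ {X Y Z} {s : CRelation L Y Z} {r : CRelation L X Y} {x y z} →
    Maps r x y → Maps s y z → Maps (s ∘ᵣ r) x z
  maps-∘ {s = s} (maps h u) (maps k v) =
    -- Any other middle value equals the given one by uniqueness for `r`, so `k′` can be moved there
    -- before uniqueness for `s` applies.
    maps (_ , h , k) (λ (_ , h′ , k′) → v (rel-resp s (sym (u h′)) refl k′))

  maps-⊗ : ∀ {X Y X′ Y′} {r : CRelation L X Y} {s : CRelation L X′ Y′} {x y x′ y′} →
    Maps r x y → Maps s x′ y′ → Maps (r ⊗ᵣ s) (pair L x x′) (pair L y y′)
  maps-⊗ {r = r} {s} (maps h u) (maps k v) = maps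
    (rel-resp r (sym fst-pair) (sym fst-pair) h , rel-resp s (sym snd-pair) (sym snd-pair) k)
    (λ (h′ , k′) → sym (pair-unique (sym (u (rel-resp r fst-pair refl h′)))
                                    (sym (v (rel-resp s snd-pair refl k′)))))

  -- Two relations with the same single value at every argument coincide. Since both respect
  -- equality, each argument may be replaced by an equal `x′`, in practice its nested tuple form.
  maps-≐ : ∀ {X Y} {r s : CRelation L X Y} →
    (∀ x → Σ[ x′ ∈ El X ] Σ[ y ∈ El Y ] x′ ≈ x × Maps r x′ y × Maps s x′ y) → _≐_ L r s
  maps-≐ {r = r} {s} c =
      (λ h → let _ , _ , e , maps _ u , maps k _ = c _ in
         rel-resp s e (u (rel-resp r (sym e) refl h)) k)
    , (λ h → let _ , _ , e , maps k _ , maps _ u = c _ in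
         rel-resp r e (u (rel-resp s (sym e) refl h)) k)

  -- Graphs of morphisms as C-relations.

  module _ (G : GraphsAreCRelations L) where

    graph : ∀ {X Y} → Morphism X Y → CRelation L X Y
    graph f = crel _ (G f)

    idᵣ : ∀ {X} → CRelation L X X
    idᵣ = graph idₘ

    maps-graph : ∀ {X Y} (f : Morphism X Y) {x y} → (f $ₘ x) ≈ y → Maps (graph f) x y
    maps-graph f e = maps e (λ e′ → trans (sym e) e′)

    maps-id : ∀ {X} {x : El X} → Maps idᵣ x x
    maps-id = maps-graph idₘ refl

    graph-pre : ∀ {X Y Z} (f : Morphism X Y) (s : CRelation L Y Z) →
      B._⇔_ (rel (s ∘ᵣ graph f)) (λ x z → rel s (f $ₘ x) z)
    graph-pre f s = (λ (_ , e , h) → rel-resp s (sym e) refl h) , (λ h → _ , refl , h)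

    record Bijective {X Y} (f : Morphism X Y) (f⁻¹ : Morphism Y X) : Set (o ⊔ m ⊔ ℓ) where
      constructor bijective
      field
        leftInverse  : ∀ x → (f⁻¹ $ₘ f $ₘ x) ≈ x
        rightInverse : ∀ y → (f $ₘ f⁻¹ $ₘ y) ≈ y

    open Bijective

    inverse : ∀ {X Y} {f : Morphism X Y} {f⁻¹} → Bijective f f⁻¹ → Bijective f⁻¹ f
    inverse (bijective l r) = bijective r l

    -- A middle value whose image under `f` is `z` must be the inverse image of `z`, so the
    -- existential quantifier disappears.
    graph-post : ∀ {X Y Z} {f : Morphism Y Z} {f⁻¹} (b : Bijective f f⁻¹)
      (r : CRelation L X Y) →
      B._⇔_ (rel (graph f ∘ᵣ r)) (λ x z → rel r x (f⁻¹ $ₘ z))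
    graph-post {f⁻¹ = f⁻¹} b r =
        (λ (_ , h , e) →
          rel-resp r refl (trans (sym (leftInverse b _)) (Func.cong (fun f⁻¹) e)) h)
      , (λ h → _ , h , rightInverse b _)

    -- Both composites with graphs become substitutions, so a naturality square reduces to one
    -- equivalence without quantifiers over middle values.
    graph-natural : ∀ {X Y X′ Y′} (f : Morphism X X′) {g : Morphism Y Y′} {g⁻¹}
      (b : Bijective g g⁻¹) (r : CRelation L X Y) (s : CRelation L X′ Y′) →
      B._⇔_ (λ x y → rel r x (g⁻¹ $ₘ y)) (λ x y → rel s (f $ₘ x) y) →
      _≐_ L (graph g ∘ᵣ r) (s ∘ᵣ graph f)
    graph-natural f b r s e =
      ⇔.trans (graph-post b r) (⇔.trans e (⇔.sym (graph-pre f s)))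
    graph-inverse : ∀ {X Y} {f : Morphism X Y} {f⁻¹} → Bijective f f⁻¹ →
      _≐_ L (graph f⁻¹ ∘ᵣ graph f) idᵣ
    graph-inverse {f = f} {f⁻¹} b = maps-≐ λ x → _ , _ , refl
      , maps-∘ (maps-graph f refl) (maps-graph f⁻¹ (leftInverse b x)) , maps-id

    graph-conjugate : ∀ {X Y X′ Y′} (f : Morphism X′ X) {g : Morphism Y Y′} {g⁻¹}
      (b : Bijective g g⁻¹) (r : CRelation L X Y) →
      B._⇔_ (rel (graph g ∘ᵣ r ∘ᵣ graph f)) (λ x y → rel r (f $ₘ x) (g⁻¹ $ₘ y))
    graph-conjugate f b r =
      -- The second equivalence is expanded so that its target argument can be instantiated at the
      -- inverse image under `g`.
      ⇔.trans (graph-post b (r ∘ᵣ graph f)) ((λ h → proj₁ (graph-pre f r) h) , (λ h → proj₂ (graph-pre f r) h))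

    -- The structural morphisms are bijections.

    α-bijective : ∀ {X Y Z} → Bijective (αₘ {X} {Y} {Z}) αₘ⁻¹
    α-bijective = bijective
      (λ p → trans (Func.cong (fun αₘ⁻¹) (trans (Func.cong (fun αₘ) (sym pair₃-η)) αₘ-pair))
                   (trans αₘ⁻¹-pair pair₃-η))
      (λ p → trans (Func.cong (fun αₘ) (trans (Func.cong (fun αₘ⁻¹) (sym pair₃-η′)) αₘ⁻¹-pair))
                   (trans αₘ-pair pair₃-η′))

    lu-bijective : ∀ {X} → Bijective (π₂ {𝟙 L} {X}) luₘ⁻¹
    lu-bijective = bijective (λ p → trans luₘ⁻¹-pair pair-η) snd-⟪⟫

    ru-bijective : ∀ {X} → Bijective (π₁ {X} {𝟙 L}) ruₘ⁻¹
    ru-bijective = bijective (λ p → trans ruₘ⁻¹-pair pair-η) fst-⟪⟫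

    σ-bijective : ∀ {X Y} → Bijective (σₘ {X} {Y}) σₘ
    σ-bijective = bijective involutive involutive
      where
      involutive : ∀ {X Y} (p : El (X ⊗ Y)) → (σₘ $ₘ σₘ $ₘ p) ≈ p
      involutive p = trans (⟪⟫-≈ (snd-⟪⟫ p) (fst-⟪⟫ p)) pair-η

    -- Rel(C) as a traced symmetric monoidal category.

    relCategory : Category (CRelation L) (_≐_ L)
    relCategory = record
      { id        = idᵣ
      ; _∘_       = _∘ᵣ_
      ; equiv     = record { IsEquivalence ⇔-isEquivalence }
      ; ∘-resp-≈  = λ (to , from) (to′ , from′) →
          (λ (_ , h , k) → _ , to′ h , to k) , (λ (_ , h , k) → _ , from′ h , from k)
      ; identityˡ = λ {f = r} →
          (λ (_ , h , e) → rel-resp r refl e h) , (λ h → _ , h , refl)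
      ; identityʳ = λ {f = r} → graph-pre idₘ r
      ; assoc     =
          (λ (_ , h , _ , k , l) → _ , (_ , h , k) , l)
        , (λ (_ , (_ , h , k) , l) → _ , h , _ , k , l)
      }

    relMonoidal : SymmetricMonoidal relCategory (_⊠_ L) (𝟙 L)
    relMonoidal = record
      { _⊗₁_ = _⊗ᵣ_
      ; ⊗-resp-≈ = λ (to , from) (to′ , from′) →
          (λ (h , k) → to h , to′ k) , (λ (h , k) → from h , from′ k)
      ; ⊗-identity =
          (λ (e , e′) → trans (pair-unique e e′) pair-η) , (λ e → fst-cong e , snd-cong e)
      ; ⊗-homomorphism = λ {f = f} {g} {f′} {g′} →
          -- The middle values of the two composites are joined into one middle pair.
          (λ ((_ , h , k) , (_ , h′ , k′)) → pair L _ _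
            , (rel-resp f refl (sym fst-pair) h , rel-resp f′ refl (sym snd-pair) h′)
            , (rel-resp g (sym fst-pair) refl k , rel-resp g′ (sym snd-pair) refl k′))
        , (λ (_ , (h , h′) , (k , k′)) → (_ , h , k) , (_ , h′ , k′))

      ; α   = graph αₘ
      ; α⁻¹ = graph αₘ⁻¹
      ; α-isoˡ = graph-inverse α-bijective
      ; α-isoʳ = graph-inverse (inverse α-bijective)
      ; α-natural = λ {f = r} {s} {t} →
          graph-natural αₘ α-bijective ((r ⊗ᵣ s) ⊗ᵣ t) (r ⊗ᵣ (s ⊗ᵣ t))
            ( (λ ((h , k) , l) →
                  rel-resp r (sym (fst-⟪⟫ _)) (trans (fst-cong (fst-⟪⟫ _)) (fst-⟪⟫ _)) h
                , rel-resp s (sym (trans (fst-cong (snd-⟪⟫ _)) (fst-⟪⟫ _)))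
                             (trans (snd-cong (fst-⟪⟫ _)) (snd-⟪⟫ _)) k
                , rel-resp t (sym (trans (snd-cong (snd-⟪⟫ _)) (snd-⟪⟫ _))) (snd-⟪⟫ _) l)
            , (λ (h , k , l) →
                  ( rel-resp r (fst-⟪⟫ _) (sym (trans (fst-cong (fst-⟪⟫ _)) (fst-⟪⟫ _))) h
                  , rel-resp s (trans (fst-cong (snd-⟪⟫ _)) (fst-⟪⟫ _))
                               (sym (trans (snd-cong (fst-⟪⟫ _)) (snd-⟪⟫ _))) k )
                , rel-resp t (trans (snd-cong (snd-⟪⟫ _)) (snd-⟪⟫ _)) (sym (snd-⟪⟫ _)) l) )

      ; lu   = graph π₂
      ; lu⁻¹ = graph luₘ⁻¹
      ; lu-isoˡ = graph-inverse lu-bijective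
      ; lu-isoʳ = graph-inverse (inverse lu-bijective)
      ; lu-natural = λ {f = r} → graph-natural π₂ lu-bijective (idᵣ ⊗ᵣ r) r
          ( (λ (_ , h) → rel-resp r refl (snd-⟪⟫ _) h)
          -- The identity factor acts on the unit object, where any two elements are equal.
          , (λ h → 𝟙-unique , rel-resp r refl (sym (snd-⟪⟫ _)) h) )

      ; ru   = graph π₁
      ; ru⁻¹ = graph ruₘ⁻¹
      ; ru-isoˡ = graph-inverse ru-bijective
      ; ru-isoʳ = graph-inverse (inverse ru-bijective)
      ; ru-natural = λ {f = r} → graph-natural π₁ ru-bijective (r ⊗ᵣ idᵣ) r
          ( (λ (h , _) → rel-resp r refl (fst-⟪⟫ _) h)
          , (λ h → rel-resp r refl (sym (fst-⟪⟫ _)) h , 𝟙-unique) )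

      -- Both sides send `((a , t) , b)` to `(a , b)`.
      ; triangle = maps-≐ λ p → _ , _ , pair₃-η
          , maps-∘ (maps-graph αₘ αₘ-pair) (maps-⊗ maps-id (maps-graph π₂ snd-pair))
          , maps-⊗ (maps-graph π₁ fst-pair) maps-id
      -- Both sides send `(((a , b) , c) , d)` to `(a , (b , (c , d)))`.
      ; pentagon = maps-≐ λ p → _ , _ , trans (pair-cong pair₃-η refl) pair-η
          , maps-∘ (maps-∘ (maps-⊗ (maps-graph αₘ αₘ-pair) maps-id) (maps-graph αₘ αₘ-pair))
                   (maps-⊗ maps-id (maps-graph αₘ αₘ-pair))
          , maps-∘ (maps-graph αₘ αₘ-pair) (maps-graph αₘ αₘ-pair)

      ; σ = graph σₘ
      ; σ-natural = λ {f = r} {s} → graph-natural σₘ σ-bijective (r ⊗ᵣ s) (s ⊗ᵣ r)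
          ( (λ (h , k) → rel-resp s (sym (fst-⟪⟫ _)) (snd-⟪⟫ _) k
                       , rel-resp r (sym (snd-⟪⟫ _)) (fst-⟪⟫ _) h)
          , (λ (k , h) → rel-resp r (snd-⟪⟫ _) (sym (fst-⟪⟫ _)) h
                       , rel-resp s (fst-⟪⟫ _) (sym (snd-⟪⟫ _)) k) )
      ; σ-involutive = graph-inverse σ-bijective
      -- Both sides send `((a , b) , c)` to `(b , (c , a))`.
      ; hexagon = maps-≐ λ p → _ , _ , pair₃-η
          , maps-∘ (maps-∘ (maps-⊗ (maps-graph σₘ σₘ-pair) maps-id) (maps-graph αₘ αₘ-pair))
                   (maps-⊗ maps-id (maps-graph σₘ σₘ-pair))
          , maps-∘ (maps-∘ (maps-graph αₘ αₘ-pair) (maps-graph σₘ σₘ-pair)) (maps-graph αₘ αₘ-pair)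
      }

    relTraced : Traced relMonoidal
    relTraced = record
      { tr = trᵣ
      ; tr-resp-≈ = λ (to , from) → (λ (_ , h) → _ , to h) , (λ (_ , h) → _ , from h)
      -- The identity factors carry the feedback value unchanged past `g` and `k`, so `f` sees the
      -- same value on both sides.
      ; tightening = λ {g = g} {f} {k} →
          (λ (_ , _ , (_ , (h , e) , l) , (j , e′)) →
              _ , (_ , rel-resp g fst-pair refl h
                    , _ , rel-resp f (pair-unique refl (trans (sym e) snd-pair))
                                     (pair-unique refl (trans e′ snd-pair)) l)
                , rel-resp k refl fst-pair j)
        , (λ (_ , (_ , h , z , l) , j) → z , _
            , (_ , (rel-resp g (sym fst-pair) (sym fst-pair) h , trans snd-pair (sym snd-pair)) , l)
            , (rel-resp k (sym fst-pair) (sym fst-pair) j , trans snd-pair (sym snd-pair)))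
      -- The feedback value in `Z` and the middle value in `Z′` exchange roles: on either side `f`
      -- relates `(x , z)` to `(y , z′)` and `g` relates `z′` to `z`.
      ; sliding = λ {f = f} {g} →
          (λ (z , _ , h , (e , k)) → _ , _
            , (trans fst-pair (sym fst-pair) , rel-resp g (sym snd-pair) (sym snd-pair)
                                                 (rel-resp g refl snd-pair k))
            , rel-resp f refl (pair-unique (trans e fst-pair) refl) h)
        , (λ (z , _ , (e , k) , h) → _ , _
            , rel-resp f (pair-unique (trans (sym e) fst-pair) refl) refl h
            , ( trans fst-pair (sym fst-pair)
              , rel-resp g (trans snd-pair (sym snd-pair)) (sym snd-pair) k ))
      ; vanishing-I = λ {f = f} → ⇔.trans
          ( (λ (_ , h) → rel-resp f (sym ruₘ⁻¹-pair) (sym ruₘ⁻¹-pair) h)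
          -- The trace needs some element of the unit object; the terminal morphism applied to `x`
          -- supplies one.
          , (λ {x} h → (!ₘ $ₘ x) , rel-resp f ruₘ⁻¹-pair ruₘ⁻¹-pair h) )
          (⇔.sym (graph-conjugate ruₘ⁻¹ ru-bijective f))
      ; vanishing-⊗ = λ {f = f} →
          -- A feedback value in the product splits into the values for the outer and the inner
          -- trace.
          (λ (z , h) → _ , _ , rel-resp f αₘ⁻¹-pairʳ αₘ⁻¹-pairʳ
            (proj₁ (graph-conjugate αₘ⁻¹ α-bijective f) h))
        , (λ (z , w , h) → pair L z w
            , proj₂ (graph-conjugate αₘ⁻¹ α-bijective f)
                (rel-resp f (sym αₘ⁻¹-pair) (sym αₘ⁻¹-pair) h))
      ; superposing = λ {W} {f = f} →
          (λ (z , h) →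
            let e , k = proj₁ (graph-conjugate αₘ (inverse α-bijective) (idᵣ {W} ⊗ᵣ f)) h in
              trans (sym fst-αₘ) (trans e fst-αₘ) , z , rel-resp f snd-αₘ snd-αₘ k)
        , (λ (e , z , h) → z
            , proj₂ (graph-conjugate αₘ (inverse α-bijective) (idᵣ {W} ⊗ᵣ f))
                ( trans fst-αₘ (trans e (sym fst-αₘ))
                , rel-resp f (sym snd-αₘ) (sym snd-αₘ) h ))
      ; yanking =
          -- The swap turns `(x , z)` into `(z , x)`; equality with `(y , z)` gives `x ≈ z` and
          -- `z ≈ y`. Conversely, `z` is taken to be `y`.
          (λ (_ , h) → let e = trans (sym σₘ-pair) h in
            trans (pair-injective₂ e) (pair-injective₁ e))
        , (λ e → _ , trans σₘ-pair (pair-cong refl e))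
      }
      where
      fst-αₘ : ∀ {X Y Z} {p : El (X ⊗ Y)} {z : El Z} → fst L (αₘ $ₘ pair L p z) ≈ fst L p
      fst-αₘ = trans (fst-⟪⟫ _) (fst-cong fst-pair)

      αₘ⁻¹-pairʳ : ∀ {X Y Z} {x : El X} {q : El (Y ⊗ Z)} →
        (αₘ⁻¹ $ₘ pair L x q) ≈ pair L (pair L x (fst L q)) (snd L q)
      αₘ⁻¹-pairʳ = trans (Func.cong (fun αₘ⁻¹) (pair-cong refl (sym pair-η))) αₘ⁻¹-pair

      snd-αₘ : ∀ {X Y Z} {p : El (X ⊗ Y)} {z : El Z} →
        snd L (αₘ $ₘ pair L p z) ≈ pair L (snd L p) z
      snd-αₘ = trans (snd-⟪⟫ _) (⟪⟫-≈ (snd-cong fst-pair) snd-pair)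

    -- The embedding of C and the functional C-relations.

    relFunctor : Functor category relCategory id
    relFunctor = record
      { F₁           = graph
      ; F-resp-≈     = λ e → (λ h → trans (sym (e _)) h) , (λ h → trans (e _) h)
      ; identity     = ⇔.refl
      ; homomorphism = λ {f = f} {g} → maps-≐ λ x → _ , _ , refl
          , maps-graph (g ∘ₘ f) refl , maps-∘ (maps-graph f refl) (maps-graph g refl)
      }

    functionOf : ∀ {X Y} (r : CRelation L X Y) → IsFunctional L r → Func ∣ X ∣ ∣ Y ∣
    functionOf r r-fun = record
      { to   = λ x → proj₁ (r-fun x)
      ; cong = λ {x} {x′} e →
          -- The value at `x′` is also related to `x`, because `r` respects equality; uniqueness at
          -- `x` then identifies the two values.
          let _ , _ , u = r-fun x ; _ , h , _ = r-fun x′ in u (rel-resp r (sym e) refl h)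
      }

    functionOf-graph : ∀ {X Y} (r : CRelation L X Y) (r-fun : IsFunctional L r) →
      B._⇔_ (Graph L {X} {Y} (functionOf r r-fun)) (rel r)
    functionOf-graph r r-fun =
        (λ e → rel-resp r refl e (proj₁ (proj₂ (r-fun _))))
      , (λ h → proj₂ (proj₂ (r-fun _)) h)

theorem5p1 : ∀ {o m ℓ : Level} (C : ConcreteCategory o m ℓ) (L : SetFiniteLimits C) →
    let open ConcreteCategory C in
    GraphsAreCRelations L →
    Σ[ 𝓡 ∈ Category (CRelation L) (_≐_ L) ]
    Σ[ ℳ ∈ SymmetricMonoidal 𝓡 (_⊠_ L) (𝟙 L) ]
    Σ[ 𝒯 ∈ Traced ℳ ]
    Σ[ ι ∈ Functor category 𝓡 id ]
    IsRelational L 𝓡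
    × IsCartesian L ℳ
    × IsCartesianTrace L 𝒯
    × Functor.Faithful ι
    × (∀ {X Y} (f : Morphism X Y) → B._⇔_ (rel (Functor.F₁ ι f)) (Graph L {X} {Y} (fun f)))
    × ((∀ {X Y} (f : Func ∣ X ∣ ∣ Y ∣) → IsMorphism f ⇔ IsCRelation L {X} {Y} (Graph L {X} {Y} f)) →
    ∀ {X Y} (r : CRelation L X Y) →
    (∃ λ (f : Morphism X Y) → _≐_ L (Functor.F₁ ι f) r) ⇔ IsFunctional L r)
theorem5p1 C L G =
  relCategory L G , relMonoidal L G , relTraced L G , relFunctor L G
  , record { id-rel = ⇔.refl ; ∘-rel = λ _ _ → ⇔.refl }
  , record
      { ⊗-rel  = λ _ _ → ⇔.refl
      ; α-rel  = αₘ-graph L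
      ; lu-rel = ⇔.refl
      ; ru-rel = ⇔.refl
      ; σ-rel  = σₘ-graph L
      }
  , (λ _ → ⇔.refl)
  -- The point `(x , g x)` lies on the graph of `g`, hence on that of `f`, which says that
  -- `f x ≈ g x`.
  , (λ {_} {Y} (_ , from) x → from (Setoid.refl ∣ Y ∣))
  , (λ _ → ⇔.refl)
  , λ graphs {X} {Y} r → mk⇔
      (λ (f , to , from) x → (fun f ⟨$⟩ x) , to (Setoid.refl ∣ Y ∣) , from)
      (λ r-fun →
        let e = functionOf-graph L G r r-fun in
        -- The graph of the extracted function is `r`, so the parametrization of `r` also serves the
        -- graph, and the hypothesis on graphs makes the function a morphism.
        mor (functionOf L G r r-fun) (Equivalence.from (graphs _)
          (IsCRelation-resp L (⇔.sym e) (isCRelation r))) , e)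
  where
  open ConcreteCategory C
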